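{- For all integers $\ell\geq 2$ and $k\geq 3$ there is a minimum integer $\mathrm{ES}(k,\ell)$ such that every finite set of at least $\mathrm{ES}(k,\ell)$ points in the plane contains $\ell$ collinear points or $k$ points in strictly convex position.
   Context: For a finite set $P$ of points in the plane, $\mathrm{conv}(P)$ denotes its convex hull. A point $v\in P$ is a corner of $P$ if $\mathrm{conv}(P\setminus\{v\})\neq\mathrm{conv}(P)$. $P$ is in strictly convex position if each point of $P$ is a corner of $P$. -}

module Defs where

open import Algebra.Bundles using (CommutativeRing)
open import Data.List.Base using (List; length)
open import Data.Nat.Base as ℕ using (ℕ)
open import Data.Product.Base using (∃-syntax; Σ-syntax; _×_; _,_; proj₁; proj₂)
open import Data.Product.Relation.Binary.Pointwise.NonDependent using (×-setoid)
open import Data.Vec.Functional using (Vector)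
open import Level using (_⊔_; suc)
open import Relation.Binary.Bundles using (Setoid)
open import Relation.Binary.Core using (Rel)
open import Relation.Binary.PropositionalEquality.Core using (_≡_)
open import Relation.Binary.Structures using (IsStrictTotalOrder)
open import Relation.Nullary.Negation.Core using (¬_)
open import Relation.Unary using (Pred; Satisfiable; _≐_)
import Algebra.Properties.Monoid.Sum as Sum
import Data.List.Membership.Setoid as Membership
import Data.List.Relation.Binary.Subset.Setoid as Subset
import Data.List.Relation.Unary.Unique.Setoid as Unique
import Relation.Binary.Construct.StrictToNonStrict as StrictToNonStrict

-- Dedekind-complete ordered fields. Classically there is exactly one up to
-- isomorphism, the field of real numbers.

record CompleteOrderedField c ℓ₁ ℓ₂ : Set (suc (c ⊔ ℓ₁ ⊔ ℓ₂)) where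
  infix 4 _<_ _≤_
  field
    commutativeRing : CommutativeRing c ℓ₁

  open CommutativeRing commutativeRing public

  field
    1≉0     : ¬ 1# ≈ 0#
    inverse : ∀ x → ¬ x ≈ 0# → ∃[ y ] x * y ≈ 1#

    _<_                : Rel Carrier ℓ₂
    isStrictTotalOrder : IsStrictTotalOrder _≈_ _<_
    +-monoˡ-<          : ∀ {x y} z → x < y → x + z < y + z
    *-pos              : ∀ {x y} → 0# < x → 0# < y → 0# < x * y

  _≤_ : Rel Carrier (ℓ₁ ⊔ ℓ₂)
  _≤_ = StrictToNonStrict._≤_ _≈_ _<_

  IsUpperBound : ∀ {s} → Pred Carrier s → Pred Carrier (c ⊔ ℓ₁ ⊔ ℓ₂ ⊔ s)
  IsUpperBound S b = ∀ {x} → S x → x ≤ b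

  field
    complete : (S : Pred Carrier (c ⊔ ℓ₁ ⊔ ℓ₂)) →
               Satisfiable S → Satisfiable (IsUpperBound S) →
               ∃[ s ] IsUpperBound S s × (∀ {b} → IsUpperBound S b → s ≤ b)

module Plane {c ℓ₁ ℓ₂} (ℝ : CompleteOrderedField c ℓ₁ ℓ₂) where
  open CompleteOrderedField ℝ
  open Sum +-monoid using (sum)

  pointSetoid : Setoid c ℓ₁
  pointSetoid = ×-setoid setoid setoid

  open Setoid pointSetoid public
    using () renaming (Carrier to Point; _≈_ to _≈ₚ_)
  open Membership pointSetoid public using (_∈_)
  open Subset pointSetoid public using () renaming (_⊆_ to _⊆ₗ_)
  open Unique pointSetoid public using (Unique)

  -- The points are pairwise distinct up to _≈ₚ_, so the length of the list is
  -- the cardinality of the set.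
  record FiniteSet : Set (c ⊔ ℓ₁) where
    field
      points : List Point
      unique : Unique points

    size : ℕ
    size = length points

    ⟦_⟧ : Pred Point (c ⊔ ℓ₁)
    ⟦_⟧ = _∈ points

  open FiniteSet public

  infix 4 _⊆_
  _⊆_ : Rel FiniteSet (c ⊔ ℓ₁)
  Q ⊆ P = points Q ⊆ₗ points P

  infixl 6 _∖_
  _∖_ : ∀ {s} → Pred Point s → Point → Pred Point (ℓ₁ ⊔ s)
  (S ∖ v) q = S q × ¬ q ≈ₚ v

  -- The set of all finite convex combinations of points of S.
  conv : ∀ {s} → Pred Point s → Pred Point (c ⊔ ℓ₁ ⊔ ℓ₂ ⊔ s)
  conv S q =
    ∃[ n ] Σ[ w ∈ Vector Carrier n ] Σ[ p ∈ Vector Point n ]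
      (∀ i → 0# ≤ w i) × sum w ≈ 1# × (∀ i → S (p i)) ×
      q ≈ₚ ( sum (λ i → w i * proj₁ (p i))
           , sum (λ i → w i * proj₂ (p i)) )

  IsCorner : FiniteSet → Pred Point (c ⊔ ℓ₁ ⊔ ℓ₂)
  IsCorner P v = v ∈ points P × ¬ (conv (⟦ P ⟧ ∖ v) ≐ conv ⟦ P ⟧)

  StrictlyConvexPosition : Pred FiniteSet (c ⊔ ℓ₁ ⊔ ℓ₂)
  StrictlyConvexPosition P = ∀ {v} → v ∈ points P → IsCorner P v

  Collinear : Pred FiniteSet (c ⊔ ℓ₁)
  Collinear P =
    ∃[ a ] ∃[ b ] ∃[ d ]
      ¬ (a ≈ 0# × b ≈ 0#) ×
      (∀ {q} → q ∈ points P → a * proj₁ q + b * proj₂ q ≈ d)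

  Contains : ∀ {s} → ℕ → Pred FiniteSet s → Pred FiniteSet (c ⊔ ℓ₁ ⊔ s)
  Contains n 𝒫 P = ∃[ Q ] Q ⊆ P × size Q ≡ n × 𝒫 Q

IsMinimum : ∀ {p} → Pred ℕ p → Pred ℕ p
IsMinimum P n = P n × (∀ {m} → P m → n ℕ.≤ m)

{-# OPTIONS --safe #-}

-- Colour each ordered triple of points by its orientation: clockwise,
-- counterclockwise or collinear. Ramsey's theorem for triples, applied to the
-- points in an arbitrary order, gives a long subsequence all of whose ordered
-- triples have the same colour. If the colour is "collinear", the subsequence
-- lies on a line. Otherwise it is in strictly convex position: orientation is
-- invariant under cyclic shifts, so any point v can be moved to the front
-- v, u, …, w, and then x ↦ orient(v,u,x) + orient(w,v,x) is an affine function
-- that vanishes at v and has constant sign on all other points.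

module Submission where

open import Defs
open import Axiom.ExcludedMiddle using (ExcludedMiddle)
open import Data.Nat.Base using (ℕ; _≤_)
open import Data.Product.Base using (∃-syntax)
open import Data.Sum.Base using (_⊎_)
open import Level using (Level; _⊔_)

open import Data.Fin.Base using (Fin; zero; suc)
open import Data.Fin.Properties using (any?; _≟_)
open import Data.List.Base
  using (List; []; _∷_; _++_; [_]; length; take; initLast; _∷ʳ′_)
open import Data.List.Membership.Propositional using (find)
open import Data.List.Membership.Propositional.Properties using (∈-∃++)
open import Data.List.Properties
  using (length-take; ++-identityʳ; ++-assoc; length-++-comm)
open import Data.List.Relation.Binary.Sublist.Propositional
  using ([]; _∷_; _∷ʳ_; minimum; lookup) renaming (_⊆_ to _⊑_; ⊆-trans to ⊑-trans)
open import Data.List.Relation.Binary.Sublist.Propositional.Properties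
  using (take-⊆; All-resp-⊆)
open import Data.List.Relation.Unary.All as All using (All; []; _∷_)
open import Data.List.Relation.Unary.All.Properties using (++⁺; ++⁻)
open import Data.List.Relation.Unary.AllPairs using (AllPairs; []; _∷_)
open import Data.Nat.Base using (zero; suc; pred; _<_; s≤s; ≢-nonZero)
open import Data.Nat.Induction using (Acc; acc; <-wellFounded)
open import Data.Nat.Properties as ℕ using (+-0-monoid; anyUpTo?)
open import Data.Product.Base
  using (∃; ∃₂; _×_; _,_; proj₁; proj₂; uncurry)
open import Data.Sum.Base using (inj₁; inj₂)
open import Data.Unit.Polymorphic.Base using (⊤; tt)
open import Data.Vec.Base as Vec using (Vec; []; _∷_)
open import Data.Vec.Functional using (Vector; updateAt; tail)
open import Data.Vec.Functional.Properties using (updateAt-updates; updateAt-minimal)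
open import Function.Base using (_∘_)
open import Level using (Lift; lift; lower)
open import Relation.Binary.Bundles using (Setoid; StrictPartialOrder)
open import Relation.Binary.Core using (Rel)
open import Relation.Binary.Definitions using (tri<; tri≈; tri>)
open import Relation.Binary.PropositionalEquality as ≡ using (_≡_; _≢_)
open import Relation.Binary.Structures using (IsStrictTotalOrder)
open import Relation.Nullary.Decidable.Core using (yes; no)
open import Relation.Nullary.Negation.Core using (¬_; contradiction)
open import Relation.Unary using (Pred; _≐_)
import Algebra.Properties.Monoid.Sum as Sum
import Algebra.Properties.Ring as RingProperties
import Algebra.Solver.Ring.NaturalCoefficients.Default as Solver
import Relation.Binary.Reasoning.Setoid as ≈-Reasoning
import Relation.Binary.Reasoning.StrictPartialOrder as StrictReasoning

private
  variable
    a p q : Level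
    A : Set a
    s : ℕ

open Sum +-0-monoid using () renaming (sum to Σℕ)

-- Ramsey's theorem

lookup≤Σℕ : (n : Vector ℕ s) (k : Fin s) → n k ≤ Σℕ n
lookup≤Σℕ n zero    = ℕ.m≤m+n _ _
lookup≤Σℕ n (suc k) = ℕ.m≤n⇒m≤o+n _ (lookup≤Σℕ (tail n) k)

-- The total target size is the measure for the inner induction of Ramsey's theorem. It drops
-- because `pred` is strict away from 0.
Σℕ-updateAt-pred : (n : Vector ℕ s) (k : Fin s) → n k ≢ 0 →
                   Σℕ (updateAt n k pred) < Σℕ n
Σℕ-updateAt-pred n zero nk≢0 with n zero
... | zero  = contradiction ≡.refl nk≢0
... | suc _ = ℕ.≤-refl
Σℕ-updateAt-pred n (suc k) nk≢0 =
  ℕ.+-monoʳ-< (n zero) (Σℕ-updateAt-pred (tail n) k nk≢0)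

-- Tuples respect the order of the list. The recursion separates those that start at the head from
-- those that avoid it, so that the Ramsey induction on `r` follows the definition.
AllTuples : ∀ r → Pred (Vec A r) p → List A → Set p
AllTuples zero    P xs       = P []
AllTuples (suc r) P []       = ⊤
AllTuples (suc r) P (x ∷ xs) = AllTuples r (P ∘ (x ∷_)) xs × AllTuples (suc r) P xs

AllTuples-resp-⊑ : ∀ r {P : Pred (Vec A r) p} {xs ys} → xs ⊑ ys →
                   AllTuples r P ys → AllTuples r P xs
AllTuples-resp-⊑ zero    τ            t        = t
AllTuples-resp-⊑ (suc r) []           t        = t
AllTuples-resp-⊑ (suc r) (_ ∷ʳ τ)     (_ , ts) = AllTuples-resp-⊑ (suc r) τ ts
AllTuples-resp-⊑ (suc r) (≡.refl ∷ τ) (t , ts) =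
  AllTuples-resp-⊑ r τ t , AllTuples-resp-⊑ (suc r) τ ts

AllTuples₁⇒All : {P : Pred (Vec A 1) p} → ∀ xs →
                 AllTuples 1 P xs → All (λ x → P (x ∷ [])) xs
AllTuples₁⇒All []       _        = []
AllTuples₁⇒All (x ∷ xs) (t , ts) = t ∷ AllTuples₁⇒All xs ts

AllTuples₂⇒AllPairs : {P : Pred (Vec A 2) p} → ∀ xs →
                      AllTuples 2 P xs → AllPairs (λ x y → P (x ∷ y ∷ [])) xs
AllTuples₂⇒AllPairs []       _        = []
AllTuples₂⇒AllPairs (x ∷ xs) (t , ts) = AllTuples₁⇒All xs t ∷ AllTuples₂⇒AllPairs xs ts

-- Colour classes are predicates that may overlap; `cover` chooses a colour for each tuple. Each
-- colour `k` has its own target size `n k`, which lets the induction lower one target at a time.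
Forces : (A : Set a) (p : Level) → ∀ r → Vector ℕ s → ℕ → Set _
Forces {s = s} A p r n N =
  (P : Fin s → Pred (Vec A r) p) → (∀ v → ∃[ k ] P k v) →
  ∀ xs → N ≤ length xs →
  ∃₂ λ k ys → ys ⊑ xs × length ys ≡ n k × AllTuples r (P k) ys

-- Homogeneity for the colouring of r-tuples obtained by fixing the first
-- element x passes to a sublist forcing n with its entry k decreased; a
-- sublist of colour k found there is extended by x.
ramsey-step : ∀ r → (∀ (n : Vector ℕ s) → ∃ (Forces A p r n)) →
              ∀ (n : Vector ℕ s) → Acc _<_ (Σℕ n) → ∃ (Forces A p (suc r) n)
ramsey-step {s = s} {A = A} {p = p} r ih n (acc rec) with any? (λ k → n k ℕ.≟ 0)
-- A target of 0 is met by the empty list.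
... | yes (k , nk≡0) = 0 , λ P cover xs _ → k , [] , minimum xs , ≡.sym nk≡0 , tt
-- The extra one pays for the first element, which is set aside.
... | no  n≢0        = suc (proj₁ forced) , force
  where
  decreased : ∀ k → ∃ (Forces A p (suc r) (updateAt n k pred))
  decreased k = ramsey-step r ih (updateAt n k pred)
    (rec (Σℕ-updateAt-pred n k (λ nk≡0 → n≢0 (k , nk≡0))))

  forced : ∃ (Forces A p r (proj₁ ∘ decreased))
  forced = ih (proj₁ ∘ decreased)

  force : Forces A p (suc r) n (suc (proj₁ forced))
  force P cover (x ∷ xs) (s≤s N≤)
    with k , ys , ys⊑xs , |ys| , hom ←
           proj₂ forced (λ k → P k ∘ (x ∷_)) (cover ∘ (x ∷_)) xs N≤
    with j , zs , zs⊑ys , |zs| , hom′ ←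
           proj₂ (decreased k) P cover ys (ℕ.≤-reflexive (≡.sym |ys|))
    with j ≟ k
  ... | no j≢k = j , zs , x ∷ʳ ⊑-trans zs⊑ys ys⊑xs ,
                 ≡.trans |zs| (updateAt-minimal j k n j≢k) , hom′
  ... | yes ≡.refl =
    k , x ∷ zs , ≡.refl ∷ ⊑-trans zs⊑ys ys⊑xs , |x∷zs| ,
    AllTuples-resp-⊑ r zs⊑ys hom , hom′
    where
    |x∷zs| : suc (length zs) ≡ n k
    |x∷zs| = ≡.trans (≡.cong suc (≡.trans |zs| (updateAt-updates k n)))
      (ℕ.suc-pred (n k) {{≢-nonZero (λ nk≡0 → n≢0 (k , nk≡0))}})

ramsey : ∀ r (n : Vector ℕ s) → ∃ (Forces A p r n)
-- The single 0-tuple has some colour `k`, so any `n k` elements will do; the sum bounds every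
-- entry.
ramsey zero n = Σℕ n , λ P cover xs N≤ →
  let k , Pk = cover []
  in  k , take (n k) xs , take-⊆ (n k) xs ,
      ≡.trans (length-take (n k) xs)
              (ℕ.m≤n⇒m⊓n≡m (ℕ.≤-trans (lookup≤Σℕ n k) N≤)) ,
      Pk
ramsey (suc r) n = ramsey-step r (ramsey r) n (<-wellFounded _)

-- Lists

AllPairs-resp-⊑ : {R : Rel A p} {xs ys : List A} →
                  xs ⊑ ys → AllPairs R ys → AllPairs R xs
AllPairs-resp-⊑ []           []       = []
AllPairs-resp-⊑ (_ ∷ʳ τ)     (_ ∷ rs) = AllPairs-resp-⊑ τ rs
AllPairs-resp-⊑ (≡.refl ∷ τ) (r ∷ rs) = All-resp-⊆ τ r ∷ AllPairs-resp-⊑ τ rs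

AllPairs-∷ʳ⁻ : {R : Rel A p} → ∀ xs {y} →
               AllPairs R (xs ++ [ y ]) → All (λ x → R x y) xs
AllPairs-∷ʳ⁻ []       _        = []
AllPairs-∷ʳ⁻ (x ∷ xs) (r ∷ rs) with _ , rxy ∷ [] ← ++⁻ xs r = rxy ∷ AllPairs-∷ʳ⁻ xs rs

AllTuples-map : ∀ r {P : Pred (Vec A r) p} {Q : Pred (Vec A r) q} → (∀ {v} → P v → Q v) →
                ∀ xs → AllTuples r P xs → AllTuples r Q xs
AllTuples-map zero    P⇒Q xs       t        = P⇒Q t
AllTuples-map (suc r) P⇒Q []       _        = tt
AllTuples-map (suc r) P⇒Q (x ∷ xs) (t , ts) =
  AllTuples-map r P⇒Q xs t , AllTuples-map (suc r) P⇒Q xs ts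

-- Appending `x` creates exactly the new tuples that end in `x`.
AllTuples-∷ʳ : ∀ r {P : Pred (Vec A (suc r)) p} xs {x} → AllTuples (suc r) P xs →
               AllTuples r (λ v → P (v Vec.∷ʳ x)) xs → AllTuples (suc r) P (xs ++ [ x ])
AllTuples-∷ʳ zero    []       _        u        = u , tt
AllTuples-∷ʳ zero    (y ∷ ys) (t , ts) u        = t , AllTuples-∷ʳ zero ys ts u
AllTuples-∷ʳ (suc r) []       _        _        = tt , tt
AllTuples-∷ʳ (suc r) (y ∷ ys) (t , ts) (u , us) =
  AllTuples-∷ʳ r ys t u , AllTuples-∷ʳ (suc r) ys ts us

-- The list is rotated one element at a time. Tuples that began with the moved head `a` now end with
-- it, which is what `cyclic` allows. Once `v` is in front, the tuples headed by `v` are read off.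
AllTuples-pivot : ∀ r {P : Pred (Vec A (suc r)) p} →
                  (∀ {x v} → P (x ∷ v) → P (v Vec.∷ʳ x)) →
                  ∀ as {v} bs → AllTuples (suc r) P (as ++ v ∷ bs) →
                  AllTuples r (P ∘ (v ∷_)) (bs ++ as)
AllTuples-pivot r cyclic [] bs (t , _) rewrite ++-identityʳ bs = t
AllTuples-pivot r {P} cyclic (a ∷ as) {v} bs (t , ts) =
  ≡.subst (AllTuples r (P ∘ (v ∷_))) (++-assoc bs [ a ] as)
    (AllTuples-pivot r cyclic as (bs ++ [ a ])
      (≡.subst (AllTuples (suc r) P) (++-assoc as (v ∷ bs) [ a ])
        (AllTuples-∷ʳ r (as ++ v ∷ bs) ts
          (AllTuples-map r cyclic (as ++ v ∷ bs) t))))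

-- Ordered fields and affine functions

module _ {c ℓ₁ ℓ₂} (ℝ : CompleteOrderedField c ℓ₁ ℓ₂) where
  open CompleteOrderedField ℝ hiding (zero)
    renaming (_<_ to _<ᵣ_; _≤_ to _≤ᵣ_; _+_ to _⊕_)
  open Plane ℝ
  open Setoid pointSetoid using () renaming (trans to ≈ₚ-trans; sym to ≈ₚ-sym)
  open Sum +-monoid using (sum)
  open IsStrictTotalOrder isStrictTotalOrder
    using (compare; irrefl; <-respʳ-≈; isStrictPartialOrder)
  open RingProperties ring using (+-cancelʳ)
  open Solver commutativeSemiring using (solve; _:=_; _:+_; _:*_; con)

  private
    strictPartialOrder : StrictPartialOrder c ℓ₁ ℓ₂
    strictPartialOrder = record { isStrictPartialOrder = isStrictPartialOrder }

    module <-Reasoning = StrictReasoning strictPartialOrder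

  +-monoʳ-< : ∀ x {y z} → y <ᵣ z → x ⊕ y <ᵣ x ⊕ z
  +-monoʳ-< x {y} {z} y<z = begin-strict
    x ⊕ y  ≈⟨ +-comm x y ⟩
    y ⊕ x  <⟨ +-monoˡ-< x y<z ⟩
    z ⊕ x  ≈⟨ +-comm z x ⟩
    x ⊕ z  ∎
    where open <-Reasoning

  +-mono-< : ∀ {x y u v} → x <ᵣ y → u <ᵣ v → x ⊕ u <ᵣ y ⊕ v
  +-mono-< {x} {y} {u} {v} x<y u<v = begin-strict
    x ⊕ u  <⟨ +-monoˡ-< u x<y ⟩
    y ⊕ u  <⟨ +-monoʳ-< y u<v ⟩
    y ⊕ v  ∎
    where open <-Reasoning

  x+[y-x]≈y : ∀ x y → x ⊕ (y - x) ≈ y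
  x+[y-x]≈y x y = begin
    x ⊕ (y ⊕ - x)  ≈⟨ +-congˡ (+-comm y (- x)) ⟩
    x ⊕ (- x ⊕ y)  ≈⟨ +-assoc x (- x) y ⟨
    (x ⊕ - x) ⊕ y  ≈⟨ +-congʳ (-‿inverseʳ x) ⟩
    0# ⊕ y         ≈⟨ +-identityˡ y ⟩
    y              ∎
    where open ≈-Reasoning setoid

  *-monoˡ-<-pos : ∀ {w x y} → 0# <ᵣ w → x <ᵣ y → w * x <ᵣ w * y
  *-monoˡ-<-pos {w} {x} {y} 0<w x<y = begin-strict
    w * x                  ≈⟨ +-identityʳ (w * x) ⟨
    w * x ⊕ 0#             <⟨ +-monoʳ-< (w * x) (*-pos 0<w 0<y-x) ⟩
    w * x ⊕ w * (y - x)    ≈⟨ distribˡ w x (y - x) ⟨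
    w * (x ⊕ (y - x))      ≈⟨ *-congˡ (x+[y-x]≈y x y) ⟩
    w * y                  ∎
    where
    open <-Reasoning
    0<y-x : 0# <ᵣ y - x
    0<y-x = begin-strict
      0#     ≈⟨ -‿inverseʳ x ⟨
      x - x  <⟨ +-monoˡ-< (- x) x<y ⟩
      y - x  ∎

  *-≈0 : ∀ {w x y} → 0# ≈ w → w * x ≈ w * y
  *-≈0 {w} {x} {y} 0≈w = begin
    w * x   ≈⟨ *-congʳ 0≈w ⟨
    0# * x  ≈⟨ zeroˡ x ⟩
    0#      ≈⟨ zeroˡ y ⟨
    0# * y  ≈⟨ *-congʳ 0≈w ⟩
    w * y   ∎
    where open ≈-Reasoning setoid

  -- Equality can occur only if all weights vanish. The first alternative records this case, since
  -- the tail of a weight vector may be zero even when the total is 1.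
  weightedSum-< : ∀ {n} (w f g : Vector Carrier n) →
                  (∀ i → 0# ≤ᵣ w i) → (∀ i → f i <ᵣ g i) →
                  (sum w ≈ 0# × sum (λ i → w i * f i) ≈ sum (λ i → w i * g i)) ⊎
                  sum (λ i → w i * f i) <ᵣ sum (λ i → w i * g i)
  weightedSum-< {zero}  w f g 0≤w f<g = inj₁ (refl , refl)
  weightedSum-< {suc n} w f g 0≤w f<g
    with 0≤w zero | weightedSum-< (tail w) (tail f) (tail g) (0≤w ∘ suc) (f<g ∘ suc)
  ... | inj₁ 0<w | inj₁ (_ , eq) =
    inj₂ (<-respʳ-≈ (+-congˡ eq) (+-monoˡ-< _ (*-monoˡ-<-pos 0<w (f<g zero))))
  ... | inj₁ 0<w | inj₂ lt =
    inj₂ (+-mono-< (*-monoˡ-<-pos 0<w (f<g zero)) lt)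
  ... | inj₂ 0≈w | inj₁ (w≈0 , eq) =
    inj₁ (trans (+-cong (sym 0≈w) w≈0) (+-identityˡ 0#) , +-cong (*-≈0 0≈w) eq)
  ... | inj₂ 0≈w | inj₂ lt =
    inj₂ (<-respʳ-≈ (+-congʳ (*-≈0 0≈w)) (+-monoʳ-< _ lt))

  Affine : Set c
  Affine = Carrier × Carrier × Carrier

  eval : Affine → Point → Carrier
  eval (α , β , γ) (x , y) = (α * x ⊕ β * y) ⊕ γ

  infixl 6 _+ᴬ_
  _+ᴬ_ : Affine → Affine → Affine
  (α , β , γ) +ᴬ (α′ , β′ , γ′) = α ⊕ α′ , β ⊕ β′ , γ ⊕ γ′

  eval-+ᴬ : ∀ L M q → eval (L +ᴬ M) q ≈ eval L q ⊕ eval M q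
  eval-+ᴬ (α , β , γ) (α′ , β′ , γ′) (x , y) =
    solve 8 (λ α β γ α′ β′ γ′ x y →
      ((α :+ α′) :* x :+ (β :+ β′) :* y) :+ (γ :+ γ′) :=
      ((α :* x :+ β :* y) :+ γ) :+ ((α′ :* x :+ β′ :* y) :+ γ′)) refl
      α β γ α′ β′ γ′ x y

  eval-cong : ∀ L {q r} → q ≈ₚ r → eval L q ≈ eval L r
  eval-cong L (x≈ , y≈) = +-congʳ (+-cong (*-congˡ x≈) (*-congˡ y≈))


  eval-sum : ∀ L {n} (w : Vector Carrier n) (p : Vector Point n) → sum w ≈ 1# →
             eval L (sum (λ i → w i * proj₁ (p i)) , sum (λ i → w i * proj₂ (p i))) ≈
             sum (λ i → w i * eval L (p i))
  eval-sum L@(α , β , γ) w p w≈1 = begin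
    -- Multiplying the constant by the total weight makes the expression linear in the weights, so
    -- the induction in `go` covers tails whose weights do not sum to 1.
    (α * _ ⊕ β * _) ⊕ γ             ≈⟨ +-congˡ (trans (*-congˡ w≈1) (*-identityʳ γ)) ⟨
    (α * _ ⊕ β * _) ⊕ γ * sum w     ≈⟨ go w p ⟩
    sum (λ i → w i * eval L (p i))  ∎
    where
    open ≈-Reasoning setoid
    go : ∀ {n} (w : Vector Carrier n) (p : Vector Point n) →
         (α * sum (λ i → w i * proj₁ (p i)) ⊕ β * sum (λ i → w i * proj₂ (p i))) ⊕
           γ * sum w ≈
         sum (λ i → w i * eval L (p i))
    go {zero}  w p = solve 3 (λ α β γ →
      (α :* con 0 :+ β :* con 0) :+ γ :* con 0 := con 0) refl α β γ
    go {suc n} w p = begin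
      _ ≈⟨ solve 9 (λ α β γ w x y X Y W →
             (α :* (w :* x :+ X) :+ β :* (w :* y :+ Y)) :+ γ :* (w :+ W) :=
             w :* ((α :* x :+ β :* y) :+ γ) :+ ((α :* X :+ β :* Y) :+ γ :* W)) refl
             α β γ (w zero) (proj₁ (p zero)) (proj₂ (p zero)) _ _ _ ⟩
      _ ≈⟨ +-congˡ (go (tail w) (tail p)) ⟩
      _ ∎

  0<1 : 0# <ᵣ 1#
  0<1 with compare 0# 1#
  ... | tri< 0<1 _ _ = 0<1
  ... | tri≈ _ 0≈1 _ = contradiction (sym 0≈1) 1≉0
  ... | tri> _ _ 1<0 = contradiction 0<0 (irrefl refl)
    where
    open <-Reasoning
    0<-1 : 0# <ᵣ - 1#
    0<-1 = begin-strict
      0#         ≈⟨ -‿inverseʳ 1# ⟨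
      1# ⊕ - 1#  <⟨ +-monoˡ-< (- 1#) 1<0 ⟩
      0# ⊕ - 1#  ≈⟨ +-identityˡ (- 1#) ⟩
      - 1#       ∎
    0<0 : 0# <ᵣ 0#
    0<0 = begin-strict
      0#         <⟨ 0<-1 ⟩
      - 1#       ≈⟨ *-identityʳ (- 1#) ⟨
      - 1# * 1#  <⟨ *-monoˡ-<-pos 0<-1 1<0 ⟩
      - 1# * 0#  ≈⟨ zeroʳ (- 1#) ⟩
      0#         ∎

  0≤1 : 0# ≤ᵣ 1#
  0≤1 = inj₁ 0<1

  ∈⇒∈conv : ∀ {s} {S : Pred Point s} {v} → S v → conv S v
  ∈⇒∈conv {v = x , y} v∈S =
    1 , (λ _ → 1#) , (λ _ → x , y) , (λ _ → 0≤1) , +-identityʳ 1# , (λ _ → v∈S) ,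
    1*≈ x , 1*≈ y
    where
    1*≈ : ∀ x → x ≈ 1# * x ⊕ 0#
    1*≈ x = sym (trans (+-identityʳ _) (*-identityˡ x))

  -- The difference of `M` and `L` vanishes at `v` but would be positive at every convex combination
  -- of the other points. Keeping two functions avoids subtraction.
  separated⇒corner : ∀ {Q v} L M → v ∈ points Q → eval L v ≈ eval M v →
                     (∀ {q} → q ∈ points Q → ¬ q ≈ₚ v → eval L q <ᵣ eval M q) →
                     IsCorner Q v
  separated⇒corner {Q} {v} L M v∈Q Lv≈Mv L<M = v∈Q , v∉
    where
    v∉ : ¬ (conv (⟦ Q ⟧ ∖ v) ≐ conv ⟦ Q ⟧)
    -- The inclusion is applied to `v` itself, which becomes a convex combination of points distinct
    -- from it.
    v∉ (_ , ⊇) with n , w , p , 0≤w , w≈1 , p∈ , v≈ ← ⊇ (∈⇒∈conv v∈Q)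
      with weightedSum-< w (eval L ∘ p) (eval M ∘ p) 0≤w (λ i → uncurry L<M (p∈ i))
    ... | inj₁ (w≈0 , _) = 1≉0 (trans (sym w≈1) w≈0)
    ... | inj₂ lt = irrefl (trans (sym (at-v L)) (trans Lv≈Mv (at-v M))) lt
      where
      at-v : ∀ N → eval N v ≈ sum (λ i → w i * eval N (p i))
      at-v N = trans (eval-cong N v≈) (eval-sum N w p w≈1)

  -- Orientations and convex position

  -- `F` is one half of an orientation: the sign of `F a b c` minus `F b a c` tells the direction of
  -- turn. Abstracting over `F` lets one proof serve both directions.
  record IsOrientation (F : Point → Point → Point → Carrier) : Set (c ⊔ ℓ₁) where
    field
      cyclic : ∀ a b c → F a b c ≈ F b c a
      form   : Point → Point → Affine
      affine : ∀ a b c → F a b c ≈ eval (form a b) c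

    -- A triple with a repeated point has orientation zero.
    degenerate : ∀ a b → F a b b ≈ F b a b
    degenerate a b = sym (cyclic b a b)

    Turn : Point → Point → Point → Set ℓ₂
    Turn a b c = F a b c <ᵣ F b a c

    Turn₃ : Pred (Vec Point 3) ℓ₂
    Turn₃ (a ∷ b ∷ c ∷ []) = Turn a b c

    Turn₃-cyclic : ∀ {a v} → Turn₃ (a ∷ v) → Turn₃ (v Vec.∷ʳ a)
    Turn₃-cyclic {a} {b ∷ c ∷ []} turn = begin-strict
      F b c a  ≈⟨ cyclic a b c ⟨
      F a b c  <⟨ turn ⟩
      F b a c  ≈⟨ cyclic c b a ⟨
      F c b a  ∎
      where open <-Reasoning

    -- With `u` first and `w` last, all of `qs` lies on one closed side of the line `vu` and of the
    -- line `wv`. The first line passes through `u` and the second through `w`, but adding the two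
    -- orientations gives strictness at both. Two points are required because for `u` equal to `w`
    -- the orientations cancel.
    supported : ∀ v qs → AllPairs (Turn v) qs → 2 ≤ length qs →
                ∃₂ λ L M → eval L v ≈ eval M v × All (λ q → eval L q <ᵣ eval M q) qs
    supported v (u ∷ qs) (us ∷ pairs) (s≤s 1≤) with initLast qs
    supported v (u ∷ .[]) _ (s≤s ()) | []
    ... | rs ∷ʳ′ w = L , M , Lv≈Mv , All.map L<M (first ∷ ++⁺ middle last)
      where
      open <-Reasoning
      -- `L` collects the positive terms of the two orientations and `M` the negative ones.
      L = form v u +ᴬ form w v
      M = form u v +ᴬ form v w

      L≈ : ∀ q → eval L q ≈ F v u q ⊕ F w v q
      L≈ q = trans (eval-+ᴬ (form v u) (form w v) q)
                   (sym (+-cong (affine v u q) (affine w v q)))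

      M≈ : ∀ q → eval M q ≈ F u v q ⊕ F v w q
      M≈ q = trans (eval-+ᴬ (form u v) (form v w) q)
                   (sym (+-cong (affine u v q) (affine v w q)))

      Lv≈Mv : eval L v ≈ eval M v
      Lv≈Mv = trans (L≈ v) (trans
        (+-cong (sym (degenerate u v)) (degenerate w v)) (sym (M≈ v)))

      L<M : ∀ {q} → F v u q ⊕ F w v q <ᵣ F u v q ⊕ F v w q → eval L q <ᵣ eval M q
      L<M {q} lt = begin-strict
        eval L q  ≈⟨ L≈ q ⟩
        _         <⟨ lt ⟩
        _         ≈⟨ M≈ q ⟨
        eval M q  ∎

      -- Cyclic shifts bring `q` to the last argument, where `affine` applies.
      toLast : ∀ {q} → Turn v q w → F w v q <ᵣ F v w q
      toLast {q} turn = begin-strict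
        F w v q  ≈⟨ cyclic w v q ⟩
        F v q w  <⟨ turn ⟩
        F q v w  ≈⟨ cyclic q v w ⟩
        F v w q  ∎

      turn-u : All (Turn v u) rs × All (Turn v u) [ w ]
      turn-u = ++⁻ rs us

      vuw : Turn v u w
      vuw = All.head (proj₂ turn-u)

      first : F v u u ⊕ F w v u <ᵣ F u v u ⊕ F v w u
      first = begin-strict
        F v u u ⊕ F w v u  ≈⟨ +-congʳ (degenerate v u) ⟩
        F u v u ⊕ F w v u  <⟨ +-monoʳ-< _ (toLast vuw) ⟩
        F u v u ⊕ F v w u  ∎

      middle : All (λ q → F v u q ⊕ F w v q <ᵣ F u v q ⊕ F v w q) rs
      middle = All.zipWith (λ (vuq , vqw) → +-mono-< vuq (toLast vqw))
                           (proj₁ turn-u , AllPairs-∷ʳ⁻ rs pairs)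

      last : All (λ q → F v u q ⊕ F w v q <ᵣ F u v q ⊕ F v w q) [ w ]
      last = (begin-strict
        F v u w ⊕ F w v w  ≈⟨ +-congˡ (degenerate v w) ⟨
        F v u w ⊕ F v w w  <⟨ +-monoˡ-< _ vuw ⟩
        F u v w ⊕ F v w w  ∎) ∷ []

    strictlyConvex : ∀ Q → 3 ≤ size Q → AllTuples 3 Turn₃ (points Q) →
                     StrictlyConvexPosition Q
    strictlyConvex Q 3≤ turns {v} v∈Q
      -- Membership holds up to `≈ₚ`, so the list is split at the actual entry `v′`.
      with v′ , v′∈ , v≈v′ ← find v∈Q
      with as , bs , eq ← ∈-∃++ v′∈
      with L , M , Lv≈Mv , L<M ←
        supported v′ (bs ++ as)
          (AllTuples₂⇒AllPairs (bs ++ as)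
            (AllTuples-pivot 2 (λ {a} {v} → Turn₃-cyclic {a} {v}) as bs
              (≡.subst (AllTuples 3 Turn₃) eq turns)))
          -- Removing the pivot from at least three points leaves the two that `supported` requires.
          (ℕ.≤-pred (≡.subst (3 ≤_)
            (≡.trans (≡.cong length eq) (length-++-comm as (v′ ∷ bs))) 3≤))
      = separated⇒corner {Q} L M v∈Q
          (trans (eval-cong L v≈v′) (trans Lv≈Mv (sym (eval-cong M v≈v′))))
          λ q∈Q q≉v → separate q≉v (All.lookupAny (≡.subst (All _) (≡.sym eq) others) q∈Q)
      where
      others : All (λ q → q ≈ₚ v′ ⊎ eval L q <ᵣ eval M q) (as ++ v′ ∷ bs)
      others with L<Mᵇ , L<Mᵃ ← ++⁻ bs L<M =
        ++⁺ (All.map inj₂ L<Mᵃ) (inj₁ (refl , refl) ∷ All.map inj₂ L<Mᵇ)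

      separate : ∀ {q r} → ¬ q ≈ₚ v → (r ≈ₚ v′ ⊎ eval L r <ᵣ eval M r) × q ≈ₚ r →
                 eval L q <ᵣ eval M q
      separate q≉v (inj₁ r≈v′ , q≈r) =
        contradiction (≈ₚ-trans q≈r (≈ₚ-trans r≈v′ (≈ₚ-sym v≈v′))) q≉v
      separate {q} {r} q≉v (inj₂ lt , q≈r) = begin-strict
        eval L q  ≈⟨ eval-cong L q≈r ⟩
        eval L r  <⟨ lt ⟩
        eval M r  ≈⟨ eval-cong M q≈r ⟨
        eval M q  ∎
        where open <-Reasoning

  -- The orientation of a triple is the sign of shoelace a b c − shoelace b a c;
  -- comparing the two terms instead avoids subtraction.
  shoelace : Point → Point → Point → Carrier
  shoelace (ax , ay) (bx , by) (cx , cy) = (ax * by ⊕ bx * cy) ⊕ cx * ay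

  shoelace-isOrientation : IsOrientation shoelace
  shoelace-isOrientation = record
    { cyclic = λ (ax , ay) (bx , by) (cx , cy) →
        solve 6 (λ ax ay bx by cx cy →
          (ax :* by :+ bx :* cy) :+ cx :* ay := (bx :* cy :+ cx :* ay) :+ ax :* by)
          refl ax ay bx by cx cy
    ; form   = λ (ax , ay) (bx , by) → ay , bx , ax * by
    ; affine = λ (ax , ay) (bx , by) (cx , cy) →
        solve 6 (λ ax ay bx by cx cy →
          (ax :* by :+ bx :* cy) :+ cx :* ay := (ay :* cx :+ bx :* cy) :+ ax :* by)
          refl ax ay bx by cx cy
    }

  -- Swapping the first two arguments reverses the direction of turn.
  reverse-isOrientation : ∀ {F} → IsOrientation F → IsOrientation (λ a b c → F b a c)
  reverse-isOrientation O = record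
    { cyclic = λ a b c → sym (cyclic c b a)
    ; form   = λ a b → form b a
    ; affine = λ a b c → affine b a c
    }
    where open IsOrientation O

  -- Flat triples and lines

  Flat₃ : Pred (Vec Point 3) ℓ₁
  Flat₃ (a ∷ b ∷ c ∷ []) = shoelace a b c ≈ shoelace b a c

  y-x≈0⇒x≈y : ∀ {x y} → y - x ≈ 0# → x ≈ y
  y-x≈0⇒x≈y {x} {y} y-x≈0 = begin
    x            ≈⟨ +-identityʳ x ⟨
    x ⊕ 0#       ≈⟨ +-congˡ y-x≈0 ⟨
    x ⊕ (y - x)  ≈⟨ x+[y-x]≈y x y ⟩
    y            ∎
    where open ≈-Reasoning setoid

  affine-≈⇒line : ∀ ((α , β , γ) (α′ , β′ , γ′) : Affine) {q} →
                  eval (α , β , γ) q ≈ eval (α′ , β′ , γ′) q →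
                  (α - α′) * proj₁ q ⊕ (β - β′) * proj₂ q ≈ γ′ - γ
  affine-≈⇒line (α , β , γ) (α′ , β′ , γ′) {x , y} eq =
    -- The added term completes every difference to the shape removed by `x+[y-x]≈y`; the rest is
    -- semiring algebra.
    +-cancelʳ ((α′ * x ⊕ β′ * y) ⊕ γ) _ _ (begin
      ((α - α′) * x ⊕ (β - β′) * y) ⊕ ((α′ * x ⊕ β′ * y) ⊕ γ)
        ≈⟨ solve 7 (λ d e α′ β′ γ x y →
             (d :* x :+ e :* y) :+ ((α′ :* x :+ β′ :* y) :+ γ) :=
             ((α′ :+ d) :* x :+ (β′ :+ e) :* y) :+ γ) refl
             (α - α′) (β - β′) α′ β′ γ x y ⟩
      ((α′ ⊕ (α - α′)) * x ⊕ (β′ ⊕ (β - β′)) * y) ⊕ γ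
        ≈⟨ +-congʳ (+-cong (*-congʳ (x+[y-x]≈y α′ α)) (*-congʳ (x+[y-x]≈y β′ β))) ⟩
      (α * x ⊕ β * y) ⊕ γ
        ≈⟨ eq ⟩
      (α′ * x ⊕ β′ * y) ⊕ γ′
        ≈⟨ +-congˡ (x+[y-x]≈y γ γ′) ⟨
      (α′ * x ⊕ β′ * y) ⊕ (γ ⊕ (γ′ - γ))
        ≈⟨ solve 3 (λ u γ g → u :+ (γ :+ g) := g :+ (u :+ γ)) refl
             (α′ * x ⊕ β′ * y) γ (γ′ - γ) ⟩
      (γ′ - γ) ⊕ ((α′ * x ⊕ β′ * y) ⊕ γ) ∎)
    where open ≈-Reasoning setoid

  -- The triples that begin with the first two points `u` and `v` put every later point on the line
  -- through them; `unique` makes this line nondegenerate.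
  flat⇒collinear : ∀ Q → 2 ≤ size Q → AllTuples 3 Flat₃ (points Q) → Collinear Q
  flat⇒collinear record { points = [] } () _
  flat⇒collinear record { points = _ ∷ [] } (s≤s ()) _
  flat⇒collinear record { points = u@(ux , uy) ∷ v@(vx , vy) ∷ qs
                        ; unique = (u≉v ∷ _) ∷ _ } _ ((flat , _) , _) =
    -- These are the coefficients of `form u v` minus `form v u`, with the constant moved to the
    -- right.
    uy - vy , vx - ux , vx * uy - ux * vy ,
    (λ (y≈ , x≈) → u≉v (y-x≈0⇒x≈y x≈ , sym (y-x≈0⇒x≈y y≈))) ,
    λ q∈ → onLine (All.lookupAny line q∈)
    where
    open IsOrientation shoelace-isOrientation

    Line : Pred Point ℓ₁
    Line q = eval (form u v) q ≈ eval (form v u) q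

    flat⇒Line : ∀ {q} → shoelace u v q ≈ shoelace v u q → Line q
    flat⇒Line {q} eq = trans (sym (affine u v q)) (trans eq (affine v u q))

    line : All Line (u ∷ v ∷ qs)
    line = flat⇒Line (sym (degenerate v u)) ∷ flat⇒Line (degenerate u v) ∷
           All.map flat⇒Line (AllTuples₁⇒All qs flat)

    onLine : ∀ {q r} → Line r × q ≈ₚ r →
             (uy - vy) * proj₁ q ⊕ (vx - ux) * proj₂ q ≈ vx * uy - ux * vy
    onLine (eq , q≈r) = affine-≈⇒line (form u v) (form v u)
      (trans (eval-cong (form u v) q≈r) (trans eq (sym (eval-cong (form v u) q≈r))))

  -- Colouring triples by orientation

  module Shoelace = IsOrientation shoelace-isOrientation
  module Shoelaceᵒᵖ = IsOrientation (reverse-isOrientation shoelace-isOrientation)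

  -- The colours are collinear, clockwise and counterclockwise, lifted to the common level that
  -- `Forces` expects.
  orientationClass : Fin 3 → Pred (Vec Point 3) (ℓ₁ ⊔ ℓ₂)
  orientationClass zero             v = Lift ℓ₂ (Flat₃ v)
  orientationClass (suc zero)       v = Lift ℓ₁ (Shoelace.Turn₃ v)
  orientationClass (suc (suc zero)) v = Lift ℓ₁ (Shoelaceᵒᵖ.Turn₃ v)

  orientationClass-covers : ∀ v → ∃[ k ] orientationClass k v
  orientationClass-covers (a ∷ b ∷ c ∷ []) with compare (shoelace a b c) (shoelace b a c)
  ... | tri< lt _ _ = suc zero , lift lt
  ... | tri≈ _ eq _ = zero , lift eq
  ... | tri> _ _ gt = suc (suc zero) , lift gt

  Unavoidable : ℕ → ℕ → ℕ → Set _
  Unavoidable ℓ k n = ∀ (P : FiniteSet) → n ≤ size P →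
    Contains ℓ Collinear P ⊎ Contains k StrictlyConvexPosition P

  erdősSzekeres : ∀ ℓ k → 2 ≤ ℓ → 3 ≤ k → ∃[ n ] Unavoidable ℓ k n
  erdősSzekeres ℓ k 2≤ℓ 3≤k = proj₁ forced , unavoidable
    where
    target : Vector ℕ 3
    target zero    = ℓ
    -- Both directions of turn yield convex position, hence the same target.
    target (suc _) = k

    forced : ∃ (Forces Point (ℓ₁ ⊔ ℓ₂) 3 target)
    forced = ramsey 3 target

    unavoidable : Unavoidable ℓ k (proj₁ forced)
    unavoidable P n≤
      with j , ys , ys⊑ , |ys| , hom ←
        proj₂ forced orientationClass orientationClass-covers (points P) n≤
      = classify j |ys| hom
      where
      Q : FiniteSet
      Q = record { points = ys ; unique = AllPairs-resp-⊑ ys⊑ (unique P) }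

      classify : ∀ j → size Q ≡ target j → AllTuples 3 (orientationClass j) ys →
                 Contains ℓ Collinear P ⊎ Contains k StrictlyConvexPosition P
      classify zero |Q| hom = inj₁ (Q , lookup ys⊑ , |Q| ,
        flat⇒collinear Q (≡.subst (2 ≤_) (≡.sym |Q|) 2≤ℓ)
          (AllTuples-map 3 lower ys hom))
      classify (suc zero) |Q| hom = inj₂ (Q , lookup ys⊑ , |Q| ,
        Shoelace.strictlyConvex Q (≡.subst (3 ≤_) (≡.sym |Q|) 3≤k)
          (AllTuples-map 3 lower ys hom))
      classify (suc (suc zero)) |Q| hom = inj₂ (Q , lookup ys⊑ , |Q| ,
        Shoelaceᵒᵖ.strictlyConvex Q (≡.subst (3 ≤_) (≡.sym |Q|) 3≤k)
          (AllTuples-map 3 lower ys hom))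

-- The least sufficient number of points

minimum-exists : ExcludedMiddle p → {P : Pred ℕ p} → ∃ P → ∃ (IsMinimum P)
minimum-exists em {P} (n , Pn) = go n (<-wellFounded n) Pn
  where
  go : ∀ n → Acc _<_ n → P n → ∃ (IsMinimum P)
  -- Excluded middle decides `P` at each smaller number, so the search either descends or certifies
  -- minimality.
  go n (acc rec) Pn with anyUpTo? (λ _ → em) n
  ... | yes (m , m<n , Pm) = go m (rec m<n) Pm
  ... | no ¬smaller        = n , Pn , λ Pm → ℕ.≮⇒≥ (λ m<n → ¬smaller (_ , m<n , Pm))

theorem2 : ∀ {c ℓ₁ ℓ₂ : Level} → ExcludedMiddle (c ⊔ ℓ₁ ⊔ ℓ₂) →
    (ℝ : CompleteOrderedField c ℓ₁ ℓ₂) → let open Plane ℝ in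
    ∀ (ℓ k : ℕ) → 2 ≤ ℓ → 3 ≤ k →
    ∃[ ES ] IsMinimum
    (λ n → ∀ (P : FiniteSet) → n ≤ size P →
    Contains ℓ Collinear P ⊎ Contains k StrictlyConvexPosition P)
    ES
theorem2 em ℝ ℓ k 2≤ℓ 3≤k = minimum-exists em (erdősSzekeres ℝ ℓ k 2≤ℓ 3≤k)
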